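{- For every integer $n \geq 5$, the complete symmetric digraph $K_n^*$ admits a $(\vec{C}_2, \vec{C}_{n-2})$-factorization.
   Context: $K_n^*$ denotes the complete symmetric digraph on $n$ vertices (for every ordered pair of distinct vertices $(u,v)$ there is exactly one arc from $u$ to $v$). $\vec{C}_m$ denotes a directed cycle of length $m$; in particular $\vec{C}_2$ on vertices $u,v$ consists of the two arcs $(u,v)$ and $(v,u)$. A directed 2-factor of a digraph $D$ is a spanning subdigraph that is a disjoint union of directed cycles. For $2\le m_1\le\dots\le m_t$ with $m_1+\dots+m_t=n$, a $(\vec{C}_{m_1},\ldots,\vec{C}_{m_t})$-factor of $D$ is a directed 2-factor consisting of $t$ pairwise vertex-disjoint directed cycles of lengths $m_1,\ldots,m_t$; a $(\vec{C}_{m_1},\ldots,\vec{C}_{m_t})$-factorization of $D$ is a partition of the arc set of $D$ into $(\vec{C}_{m_1},\ldots,\vec{C}_{m_t})$-factors. -}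

module Defs where

open import Data.Nat using (ℕ; zero; suc; _≤_; _∸_)
open import Data.Fin using (Fin; zero; suc; inject₁; fromℕ)
open import Data.Product using (Σ; ∃; _×_; _,_)
open import Relation.Binary.PropositionalEquality using (_≡_)
open import Relation.Nullary using (¬_)
open import Function.Definitions using (Injective)

-- Vertices of K_n^* are Fin n; its arcs are the ordered pairs (u , v) with u ≢ v.
Arc : ℕ → Set
Arc n = Σ (Fin n) λ u → Σ (Fin n) λ v → ¬ (u ≡ v)

-- A directed cycle of length m (m ≥ 2) in K_n^*: an injective cyclic sequence
-- of vertices  vert 0 → vert 1 → … → vert (m-1) → vert 0.
record DiCycle (n m : ℕ) : Set where
  field
    len≥2 : 2 ≤ m
    vert  : Fin m → Fin n
    inj   : Injective _≡_ _≡_ vert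

-- arcs of a cycle of length suc k
CycArc : ∀ {n k} → (Fin (suc k) → Fin n) → Fin n → Fin n → Set
CycArc {n} {k} c u v =
  (Σ (Fin k) λ i → (c (inject₁ i) ≡ u) × (c (suc i) ≡ v))
  ⊎' ((c (fromℕ k) ≡ u) × (c zero ≡ v))
  where
  open import Data.Sum using () renaming (_⊎_ to _⊎'_)

-- (u , v) is an arc of the directed cycle C
InCycle : ∀ {n m} → DiCycle n m → Fin n → Fin n → Set
InCycle {n} {zero}  C u v = Data.Empty.⊥ where import Data.Empty
InCycle {n} {suc k} C u v = CycArc (DiCycle.vert C) u v

-- A (C_{len 0}, …, C_{len (t-1)})-factor of K_n^*: t pairwise vertex-disjoint
-- directed cycles of the prescribed lengths covering all vertices.
record CycleFactor (n t : ℕ) (len : Fin t → ℕ) : Set where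
  field
    cyc      : (j : Fin t) → DiCycle n (len j)
    disjoint : ∀ j j' (i : Fin (len j)) (i' : Fin (len j')) →
               DiCycle.vert (cyc j) i ≡ DiCycle.vert (cyc j') i' → j ≡ j'
    spanning : ∀ (x : Fin n) → ∃ λ j → ∃ λ (i : Fin (len j)) → DiCycle.vert (cyc j) i ≡ x

-- arc (u , v) belongs to the factor F
InFactor : ∀ {n t len} → CycleFactor n t len → Fin n → Fin n → Set
InFactor {t = t} {len} F u v = ∃ λ (j : Fin t) → InCycle (CycleFactor.cyc F j) u v

-- A factorization of K_n^*: a family of factors (indexed by Fin k) whose arc sets
-- partition the arc set of K_n^*: every arc lies in exactly one factor.
record CycleFactorization (n t : ℕ) (len : Fin t → ℕ) : Set where
  field
    k       : ℕ
    factor  : Fin k → CycleFactor n t len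
    covers  : ∀ (a : Arc n) → let (u , v , _) = a in ∃ λ r → InFactor (factor r) u v
    unique  : ∀ (a : Arc n) → let (u , v , _) = a in
              ∀ r r' → InFactor (factor r) u v → InFactor (factor r') u v → r ≡ r'

-- lengths (2 , n - 2)
len2 : ℕ → Fin 2 → ℕ
len2 n zero       = 2
len2 n (suc zero) = n ∸ 2

module Submission where

-- Write n = M + 2 and take as vertices two points ∞₁, ∞₂ and the elements of a group G of order M.
-- Suppose p₀, …, p_{M-2} lists the non-identity elements of G so that the quotients
-- δⱼ = pⱼ⁻¹ pⱼ₊₁ are pairwise distinct and all differ from some s generating G, and let q₀, q₁, …
-- run through G with qⱼ₊₁ = qⱼ s.  Then the n − 1 factors
--   F  = the 2-cycle (∞₁ ∞₂) with the cycle q₀ → q₁ → ⋯ → q_{M-1} → q₀,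
--   Fᵢ = the 2-cycle (∞₁ i) with the cycle ∞₂ → i p₀ → i p₁ → ⋯ → i p_{M-2} → ∞₂     (i ∈ G)
-- partition the arcs of K_n^*: an arc x → y inside G lies in F if x⁻¹ y = s, and otherwise in the
-- unique Fᵢ with x⁻¹ y = δⱼ and x = i pⱼ.
-- For G = ℤ/M such sequences exist whenever M ≥ 3.  For even M take 1, −1, 2, −2, …: the
-- differences −2, 3, −4, 5, … and s = 1 are distinct modulo M, since +a ≡ −b would force
-- M ∣ a + b with a + b odd.  For M = 2h + 1 take the zigzag 1, h, 2, h − 1, … through {1, …, h} backwards, then
-- the same zigzag shifted by h: reversal negates differences, so the differences are
-- ±1, …, ±(h − 1) and the jump h in the middle, leaving s = −h.

open import Defs

open import Algebra.Bundles using (AbelianGroup; Group)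
open import Algebra.Core using (Op₁; Op₂)
open import Algebra.Structures using (IsAbelianGroup; IsGroup)
open import Data.Empty using (⊥)
open import Data.Fin using (Fin; zero; suc; toℕ; inject₁; fromℕ; punchOut)
open import Data.Fin.Properties
  using (any?; _≟_; punchOut-injective; injective⇒≤; toℕ-fromℕ<; toℕ<n; toℕ-inject₁; toℕ-fromℕ;
         toℕ-injective)
open import Data.Nat
  using (ℕ; zero; suc; _+_; _*_; _∸_; _≤_; _<_; _≤?_; _<?_; s≤s; z≤n; NonZero; >-nonZero⁻¹)
open import Data.Nat.DivMod using (_%_; _mod_; %-distribˡ-+; m<n⇒m%n≡m; [m+n]%n≡m%n)
open import Data.Nat.Divisibility
  using (_∣_; divides; ∣-trans; ∣m+n∣m⇒∣n; ∣⇒≤; >⇒∤; m%n≡0⇒n∣m)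
open import Data.Nat.Properties
  using (+-suc; +-comm; +-assoc; +-identityʳ; +-mono-≤; +-mono-<; +-mono-≤-<; +-monoˡ-≤;
         +-monoʳ-≤; +-cancelˡ-≤; +-cancelˡ-≡; +-cancelʳ-≡; +-∸-assoc; ≤-refl; ≤-reflexive;
         ≤-trans; <⇒≤; <⇒≱; ≰⇒>; ≮⇒≥; <-irrefl; m≤m+n; n≤1+n; m<n⇒m<1+n;
         suc-injective; m∸n≤m; m∸n+n≡m; m∸[m∸n]≡n; m+[n∸m]≡n; m+n∸m≡n; m<n⇒0<n∸m; ∸-cancelˡ-≡)
open import Data.Nat.Tactic.RingSolver using (solve-∀)
open import Data.Product using (∃; ∃₂; _×_; _,_; proj₁; proj₂)
open import Data.Sign.Base as Sign using (Sign)
open import Data.Sign.Properties using (s≢opposite[s])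
open import Data.Sum using (_⊎_; inj₁; inj₂)
open import Data.Vec.Functional using (_∷_)
open import Function.Base using (_∘_)
open import Function.Definitions using (Injective)
open import Level using (0ℓ)
open import Relation.Binary.PropositionalEquality
open import Relation.Nullary using (¬_; yes; no; contradiction)

-- Natural numbers: halving, interleaving, reflection

data Parity : ℕ → Set where
  even : ∀ k → Parity (k + k)
  odd  : ∀ k → Parity (suc (k + k))

parity : ∀ n → Parity n
parity zero    = even zero
parity (suc n) with parity n
... | even k = odd k
... | odd  k = subst Parity (cong suc (+-suc k k)) (even (suc k))

double-≤-cancel : ∀ {a b} → a + a ≤ b + b → a ≤ b
double-≤-cancel {a} {b} a+a≤b+b with a ≤? b
... | yes a≤b = a≤b
... | no  a≰b = contradiction a+a≤b+b (<⇒≱ (+-mono-< (≰⇒> a≰b) (≰⇒> a≰b)))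

double-<-cancel : ∀ {a b} → a + a < b + b → a < b
double-<-cancel {a} {b} a+a<b+b with a <? b
... | yes a<b = a<b
... | no  a≮b = contradiction (+-mono-≤ (≮⇒≥ a≮b) (≮⇒≥ a≮b)) (<⇒≱ a+a<b+b)

a+x≡n⇒x≡n∸a : ∀ {a x n} → a + x ≡ n → x ≡ n ∸ a
a+x≡n⇒x≡n∸a {a} {x} e = trans (sym (m+n∸m≡n a x)) (cong (_∸ a) e)

2+b+b≡1+b+1+b : ∀ b → suc (suc (b + b)) ≡ suc b + suc b
2+b+b≡1+b+1+b b = cong suc (sym (+-suc b b))

a+a≤2+b+b⇒a≤1+b : ∀ {a b} → a + a ≤ suc (suc (b + b)) → a ≤ suc b
a+a≤2+b+b⇒a≤1+b {a} {b} le = double-≤-cancel (subst (a + a ≤_) (2+b+b≡1+b+1+b b) le)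

a+a≤1+b+b⇒a≤b : ∀ {a b} → a + a ≤ suc (b + b) → a ≤ b
a+a≤1+b+b⇒a≤b {a} {b} le
  with double-<-cancel {a} {suc b} (subst (a + a <_) (2+b+b≡1+b+1+b b) (s≤s le))
... | s≤s a≤b = a≤b

2∤1+k+k : ∀ k → ¬ 2 ∣ suc (k + k)
2∤1+k+k k 2∣1+k+k = contradiction (∣⇒≤ 2∣1) λ { (s≤s ()) }
  where
  k+k≡k*2 : ∀ k → k + k ≡ k * 2
  k+k≡k*2 = solve-∀
  2∣1 : 2 ∣ 1
  2∣1 = ∣m+n∣m⇒∣n (subst (2 ∣_) (+-comm 1 (k + k)) 2∣1+k+k) (divides k (k+k≡k*2 k))

interleave : ∀ {A : Set} → (ℕ → A) → (ℕ → A) → ℕ → A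
interleave f g zero    = f zero
interleave f g (suc j) = interleave g (f ∘ suc) j

interleave-even : ∀ {A : Set} (f g : ℕ → A) k → interleave f g (k + k) ≡ f k
interleave-even f g zero    = refl
interleave-even f g (suc k) rewrite +-suc k k = interleave-even (f ∘ suc) (g ∘ suc) k

interleave-odd : ∀ {A : Set} (f g : ℕ → A) k → interleave f g (suc (k + k)) ≡ g k
interleave-odd f g k = interleave-even g (f ∘ suc) k

interleave-even′ : ∀ {A : Set} (f g : ℕ → A) k → interleave f g (suc (suc (k + k))) ≡ f (suc k)
interleave-even′ f g k = trans (cong (interleave f g) (2+b+b≡1+b+1+b k)) (interleave-even f g (suc k))

interleave-injective : ∀ {A : Set} {f g : ℕ → A} → Injective _≡_ _≡_ f → Injective _≡_ _≡_ g →
                       (∀ a b → f a ≢ g b) → Injective _≡_ _≡_ (interleave f g)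
interleave-injective {f = f} {g} f-inj g-inj f≢g {i} {j} e with parity i | parity j
... | even a | even b =
  cong (λ x → x + x) (f-inj (trans (sym (interleave-even f g a)) (trans e (interleave-even f g b))))
... | odd  a | odd  b =
  cong (λ x → suc (x + x)) (g-inj (trans (sym (interleave-odd f g a)) (trans e (interleave-odd f g b))))
... | even a | odd  b =
  contradiction (trans (sym (interleave-even f g a)) (trans e (interleave-odd f g b))) (f≢g a b)
... | odd  a | even b =
  contradiction (trans (sym (interleave-even f g b)) (trans (sym e) (interleave-odd f g a))) (f≢g b a)

alternating : ℕ → Sign
alternating = interleave (λ _ → Sign.+) (λ _ → Sign.-)

alternating-even : ∀ a → alternating (a + a) ≡ Sign.+
alternating-even = interleave-even (λ _ → Sign.+) (λ _ → Sign.-)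

alternating-odd : ∀ a → alternating (suc (a + a)) ≡ Sign.-
alternating-odd = interleave-odd (λ _ → Sign.+) (λ _ → Sign.-)

data Side (k : ℕ) : ℕ → Set where
  left  : ∀ t → t ≤ k → Side k (k ∸ t)
  right : ∀ t → Side k (suc k + t)

side : ∀ k j → Side k j
side k j with j ≤? k
... | yes j≤k = subst (Side k) (m∸[m∸n]≡n j≤k) (left (k ∸ j) (m∸n≤m k j))
... | no  j≰k = subst (Side k) (m+[n∸m]≡n (≰⇒> j≰k)) (right (j ∸ suc k))

revAppend : ∀ {A : Set} → ℕ → (ℕ → A) → (ℕ → A) → ℕ → A
revAppend k f g j with j ≤? k
... | yes _ = f (k ∸ j)
... | no  _ = g (j ∸ suc k)

revAppend-left : ∀ {A : Set} k (f g : ℕ → A) {t} → t ≤ k → revAppend k f g (k ∸ t) ≡ f t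
revAppend-left k f g {t} t≤k with (k ∸ t) ≤? k
... | yes _     = cong f (m∸[m∸n]≡n t≤k)
... | no  k∸t≰k = contradiction (m∸n≤m k t) k∸t≰k

revAppend-right : ∀ {A : Set} k (f g : ℕ → A) t → revAppend k f g (suc k + t) ≡ g t
revAppend-right k f g t with (suc k + t) ≤? k
... | yes 1+k+t≤k = contradiction (≤-trans (m≤m+n (suc k) t) 1+k+t≤k) (<-irrefl refl)
... | no  _       = cong g (m+n∸m≡n (suc k) t)

-- The cyclic group ℤ/M on Fin M

module ℤₘ (M : ℕ) .{{_ : NonZero M}} where

  0<M : 0 < M
  0<M = >-nonZero⁻¹ M

  ι : ℕ → Fin M
  ι n = n mod M

  infixl 6 _+ₘ_
  _+ₘ_ : Fin M → Fin M → Fin M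
  a +ₘ b = ι (toℕ a + toℕ b)

  -ₘ_ : Fin M → Fin M
  -ₘ a = ι (M ∸ toℕ a)

  0ₘ : Fin M
  0ₘ = ι 0

  toℕ-ι : ∀ n → toℕ (ι n) ≡ n % M
  toℕ-ι n = toℕ-fromℕ< _

  ι-toℕ : ∀ a → ι (toℕ a) ≡ a
  ι-toℕ a = toℕ-injective (trans (toℕ-ι (toℕ a)) (m<n⇒m%n≡m (toℕ<n a)))

  ι-+ : ∀ a b → ι (a + b) ≡ ι a +ₘ ι b
  ι-+ a b = toℕ-injective (begin
    toℕ (ι (a + b))                ≡⟨ toℕ-ι (a + b) ⟩
    (a + b) % M                    ≡⟨ %-distribˡ-+ a b M ⟩
    (a % M + b % M) % M            ≡⟨ cong₂ (λ x y → (x + y) % M) (toℕ-ι a) (toℕ-ι b) ⟨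
    (toℕ (ι a) + toℕ (ι b)) % M    ≡⟨ toℕ-ι _ ⟨
    toℕ (ι a +ₘ ι b)               ∎)
    where open ≡-Reasoning

  ι-+M : ∀ n → ι (n + M) ≡ ι n
  ι-+M n = toℕ-injective (trans (toℕ-ι _) (trans ([m+n]%n≡m%n n M) (sym (toℕ-ι n))))

  ι-injective : ∀ {a b} → a < M → b < M → ι a ≡ ι b → a ≡ b
  ι-injective {a} {b} a<M b<M e = begin
    a           ≡⟨ m<n⇒m%n≡m a<M ⟨
    a % M       ≡⟨ toℕ-ι a ⟨
    toℕ (ι a)   ≡⟨ cong toℕ e ⟩
    toℕ (ι b)   ≡⟨ toℕ-ι b ⟩
    b % M       ≡⟨ m<n⇒m%n≡m b<M ⟩
    b           ∎
    where open ≡-Reasoning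

  +ₘ-assoc : ∀ a b c → (a +ₘ b) +ₘ c ≡ a +ₘ (b +ₘ c)
  +ₘ-assoc a b c = begin
    ι (toℕ a + toℕ b) +ₘ c            ≡⟨ cong (ι (toℕ a + toℕ b) +ₘ_) (ι-toℕ c) ⟨
    ι (toℕ a + toℕ b) +ₘ ι (toℕ c)    ≡⟨ ι-+ _ _ ⟨
    ι (toℕ a + toℕ b + toℕ c)         ≡⟨ cong ι (+-assoc (toℕ a) _ _) ⟩
    ι (toℕ a + (toℕ b + toℕ c))       ≡⟨ ι-+ _ _ ⟩
    ι (toℕ a) +ₘ ι (toℕ b + toℕ c)    ≡⟨ cong (_+ₘ (b +ₘ c)) (ι-toℕ a) ⟩
    a +ₘ (b +ₘ c)                     ∎
    where open ≡-Reasoning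

  +ₘ-comm : ∀ a b → a +ₘ b ≡ b +ₘ a
  +ₘ-comm a b = cong ι (+-comm (toℕ a) (toℕ b))

  +ₘ-identityˡ : ∀ a → 0ₘ +ₘ a ≡ a
  +ₘ-identityˡ a = begin
    ι 0 +ₘ a            ≡⟨ cong (ι 0 +ₘ_) (ι-toℕ a) ⟨
    ι 0 +ₘ ι (toℕ a)    ≡⟨ ι-+ 0 (toℕ a) ⟨
    ι (toℕ a)           ≡⟨ ι-toℕ a ⟩
    a                   ∎
    where open ≡-Reasoning

  -ₘ-inverseˡ : ∀ a → (-ₘ a) +ₘ a ≡ 0ₘ
  -ₘ-inverseˡ a = begin
    ι (M ∸ toℕ a) +ₘ a            ≡⟨ cong (ι (M ∸ toℕ a) +ₘ_) (ι-toℕ a) ⟨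
    ι (M ∸ toℕ a) +ₘ ι (toℕ a)    ≡⟨ ι-+ _ _ ⟨
    ι (M ∸ toℕ a + toℕ a)         ≡⟨ cong ι (m∸n+n≡m (<⇒≤ (toℕ<n a))) ⟩
    ι (0 + M)                     ≡⟨ ι-+M 0 ⟩
    ι 0                           ∎
    where open ≡-Reasoning

  isAbelianGroup : IsAbelianGroup _≡_ _+ₘ_ 0ₘ -ₘ_
  isAbelianGroup = record
    { isGroup = record
      { isMonoid = record
        { isSemigroup = record
          { isMagma = record { isEquivalence = isEquivalence ; ∙-cong = cong₂ _+ₘ_ }
          ; assoc   = +ₘ-assoc
          }
        ; identity = +ₘ-identityˡ , λ a → trans (+ₘ-comm a 0ₘ) (+ₘ-identityˡ a)
        }
      ; inverse = -ₘ-inverseˡ , λ a → trans (+ₘ-comm a (-ₘ a)) (-ₘ-inverseˡ a)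
      ; ⁻¹-cong = cong -ₘ_
      }
    ; comm = +ₘ-comm
    }

  abelianGroup : AbelianGroup 0ℓ 0ℓ
  abelianGroup = record { isAbelianGroup = isAbelianGroup }

  open import Algebra.Properties.AbelianGroup abelianGroup
    using (⁻¹-injective; ⁻¹-involutive; ε⁻¹≈ε)

  ι≢0ₘ : ∀ {a} → 0 < a → a < M → ι a ≢ 0ₘ
  ι≢0ₘ {suc a} _ a<M e with ι-injective a<M 0<M e
  ... | ()

  ι≡-ₘι⇒∣ : ∀ a b → ι a ≡ -ₘ ι b → M ∣ a + b
  ι≡-ₘι⇒∣ a b e = m%n≡0⇒n∣m (a + b) M (begin
    (a + b) % M              ≡⟨ toℕ-ι (a + b) ⟨
    toℕ (ι (a + b))          ≡⟨ cong toℕ (ι-+ a b) ⟩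
    toℕ (ι a +ₘ ι b)         ≡⟨ cong (λ x → toℕ (x +ₘ ι b)) e ⟩
    toℕ ((-ₘ ι b) +ₘ ι b)    ≡⟨ cong toℕ (-ₘ-inverseˡ (ι b)) ⟩
    toℕ (ι 0)                ≡⟨ toℕ-ι 0 ⟩
    0 % M                    ≡⟨ m<n⇒m%n≡m 0<M ⟩
    0                        ∎)
    where open ≡-Reasoning

  positive<M⇒∤ : ∀ {n} → 0 < n → n < M → ¬ M ∣ n
  positive<M⇒∤ {suc n} _ n<M = >⇒∤ n<M

  signed : Sign × ℕ → Fin M
  signed (Sign.+ , a) = ι a
  signed (Sign.- , a) = -ₘ ι a

  signed-injective : ∀ {σ a τ b} → a < M → b < M → (σ ≢ τ → ¬ M ∣ a + b) →
                     signed (σ , a) ≡ signed (τ , b) → (σ , a) ≡ (τ , b)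
  signed-injective {Sign.+} {a} {Sign.+} {b} a<M b<M _ e =
    cong (Sign.+ ,_) (ι-injective a<M b<M e)
  signed-injective {Sign.-} {a} {Sign.-} {b} a<M b<M _ e =
    cong (Sign.- ,_) (ι-injective a<M b<M (⁻¹-injective e))
  signed-injective {Sign.+} {a} {Sign.-} {b} _ _ M∤a+b e =
    contradiction (ι≡-ₘι⇒∣ a b e) (M∤a+b λ ())
  signed-injective {Sign.-} {a} {Sign.+} {b} _ _ M∤a+b e =
    contradiction (subst (M ∣_) (+-comm b a) (ι≡-ₘι⇒∣ b a (sym e))) (M∤a+b λ ())

  signed≢0ₘ : ∀ {σ a} → 0 < a → a < M → signed (σ , a) ≢ 0ₘ
  signed≢0ₘ {Sign.+} 0<a a<M e = ι≢0ₘ 0<a a<M e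
  signed≢0ₘ {Sign.-} 0<a a<M e = ι≢0ₘ 0<a a<M (⁻¹-injective (trans e (sym ε⁻¹≈ε)))

  signed-opposite : ∀ σ a → signed (Sign.opposite σ , a) ≡ -ₘ signed (σ , a)
  signed-opposite Sign.+ a = refl
  signed-opposite Sign.- a = sym (⁻¹-involutive (ι a))

-- Counting in Fin

injective⇒surjective : ∀ {n} (f : Fin n → Fin n) → Injective _≡_ _≡_ f →
                       ∀ y → ∃ λ x → f x ≡ y
injective⇒surjective {suc n} f f-inj y with any? (λ x → f x ≟ y)
... | yes hit  = hit
... | no  miss = contradiction (injective⇒≤ f′-inj) (<-irrefl refl)
  where
  y≢f : ∀ x → y ≢ f x
  y≢f x y≡fx = miss (x , sym y≡fx)
  f′ : Fin (suc n) → Fin n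
  f′ x = punchOut (y≢f x)
  f′-inj : Injective _≡_ _≡_ f′
  f′-inj e = f-inj (punchOut-injective (y≢f _) (y≢f _) e)

∘toℕ-injective : ∀ {n} {A : Set} {f : ℕ → A} → (∀ {i j} → i < n → j < n → f i ≡ f j → i ≡ j) →
                 Injective _≡_ _≡_ (λ (i : Fin n) → f (toℕ i))
∘toℕ-injective f-injective e = toℕ-injective (f-injective (toℕ<n _) (toℕ<n _) e)

∷-injective : ∀ {A : Set} {n} {x : A} {f : Fin n → A} →
              (∀ i → f i ≢ x) → Injective _≡_ _≡_ f → Injective _≡_ _≡_ (x ∷ f)
∷-injective f≢x f-inj {zero}  {zero}  _ = refl
∷-injective f≢x f-inj {zero}  {suc j} e = contradiction (sym e) (f≢x j)
∷-injective f≢x f-inj {suc i} {zero}  e = contradiction e (f≢x i)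
∷-injective f≢x f-inj {suc i} {suc j} e = cong suc (f-inj e)

inject₁-or-last : ∀ {n} (i : Fin (suc n)) → (∃ λ j → i ≡ inject₁ j) ⊎ i ≡ fromℕ n
inject₁-or-last {zero}  zero    = inj₂ refl
inject₁-or-last {suc n} zero    = inj₁ (zero , refl)
inject₁-or-last {suc n} (suc i) with inject₁-or-last i
... | inj₁ (j , i≡j) = inj₁ (suc j , cong suc i≡j)
... | inj₂ i≡last    = inj₂ (cong suc i≡last)

-- One-rotational factorizations

module OneRotational {m : ℕ} {_∙_ : Op₂ (Fin (suc (suc m)))} {ε : Fin (suc (suc m))}
                     {_⁻¹ : Op₁ (Fin (suc (suc m)))} (isGroup : IsGroup _≡_ _∙_ ε _⁻¹) where

  M : ℕ
  M = suc (suc m)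

  G : Set
  G = Fin M

  group : Group 0ℓ 0ℓ
  group = record { isGroup = isGroup }

  open IsGroup isGroup using (assoc; identityʳ; _\\_; _//_)
  open import Algebra.Properties.Group group
    using (∙-cancelˡ; ∙-cancelʳ; identityʳ-unique; inverseˡ-unique; ⁻¹-injective;
           \\-leftDividesˡ; //-rightDividesˡ)

  \\≡ε⇒≡ : ∀ {x y} → x \\ y ≡ ε → x ≡ y
  \\≡ε⇒≡ {x} {y} e = ⁻¹-injective (inverseˡ-unique (x ⁻¹) y e)

  -- The sequences of the construction are functions on ℕ; only their values at indices below
  -- m + 1, m and m + 2 (the lengths of p, δ and q) matter.
  record Starter : Set where
    field
      p           : ℕ → G
      p-injective : ∀ {i j} → i < suc m → j < suc m → p i ≡ p j → i ≡ j
      p≢ε         : ∀ {j} → j < suc m → p j ≢ ε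
      δ           : ℕ → G
      p-step      : ∀ {j} → j < m → p j ∙ δ j ≡ p (suc j)
      δ-injective : ∀ {i j} → i < m → j < m → δ i ≡ δ j → i ≡ j
      s           : G
      δ≢s         : ∀ {j} → j < m → δ j ≢ s
      q           : ℕ → G
      q-injective : ∀ {i j} → i < M → j < M → q i ≡ q j → i ≡ j
      q-step      : ∀ {j} → j < suc m → q j ∙ s ≡ q (suc j)
      q-wrap      : q (suc m) ∙ s ≡ q 0

  V : Set
  V = Fin (2 + M)

  pattern ∞₁    = zero
  pattern ∞₂    = suc zero
  pattern emb x = suc (suc x)

  emb-cong : {x y : G} → x ≡ y → _≡_ {A = V} (emb x) (emb y)
  emb-cong refl = refl

  emb-injective : {x y : G} → _≡_ {A = V} (emb x) (emb y) → x ≡ y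
  emb-injective refl = refl

  Factor : Set
  Factor = CycleFactor (2 + M) 2 (len2 (2 + M))

  pairFactor : (a b : V) → a ≢ b → (f : Fin M → V) → Injective _≡_ _≡_ f →
               (∀ j → f j ≢ a) → (∀ j → f j ≢ b) →
               (∀ x → x ≢ a → x ≢ b → ∃ λ j → f j ≡ x) → Factor
  pairFactor a b a≢b f f-inj f≢a f≢b f-onto =
    record { cyc = cyc ; disjoint = disjoint ; spanning = spanning }
    where
    pair : Fin 2 → V
    pair zero       = a
    pair (suc zero) = b

    pair-injective : Injective _≡_ _≡_ pair
    pair-injective {zero}     {zero}     _ = refl
    pair-injective {zero}     {suc zero} e = contradiction e a≢b
    pair-injective {suc zero} {zero}     e = contradiction (sym e) a≢b
    pair-injective {suc zero} {suc zero} _ = refl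

    cyc : (j : Fin 2) → DiCycle (2 + M) (len2 (2 + M) j)
    cyc zero       = record { len≥2 = ≤-refl ; vert = pair ; inj = pair-injective }
    cyc (suc zero) = record { len≥2 = s≤s (s≤s z≤n) ; vert = f ; inj = f-inj }

    f≢pair : ∀ j i → f j ≢ pair i
    f≢pair j zero       = f≢a j
    f≢pair j (suc zero) = f≢b j

    disjoint : ∀ j j' (i : Fin (len2 (2 + M) j)) (i' : Fin (len2 (2 + M) j')) →
               DiCycle.vert (cyc j) i ≡ DiCycle.vert (cyc j') i' → j ≡ j'
    disjoint zero       zero       _ _  _ = refl
    disjoint zero       (suc zero) i i' e = contradiction (sym e) (f≢pair i' i)
    disjoint (suc zero) zero       i i' e = contradiction e (f≢pair i i')
    disjoint (suc zero) (suc zero) _ _  _ = refl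

    spanning : ∀ x → ∃ λ j → ∃ λ (i : Fin (len2 (2 + M) j)) → DiCycle.vert (cyc j) i ≡ x
    spanning x with x ≟ a | x ≟ b
    ... | yes x≡a | _       = zero , zero , sym x≡a
    ... | no _    | yes x≡b = zero , suc zero , sym x≡b
    ... | no x≢a  | no x≢b  = suc zero , f-onto x x≢a x≢b

  module FromStarter (S : Starter) where
    open Starter S

    s≢ε : s ≢ ε
    s≢ε s≡ε = contradiction (q-injective (s≤s z≤n) (s≤s (s≤s z≤n)) q0≡q1) λ ()
      where
      q0≡q1 : q 0 ≡ q 1
      q0≡q1 = trans (sym (identityʳ (q 0))) (trans (cong (q 0 ∙_) (sym s≡ε)) (q-step (s≤s z≤n)))

    δ≢ε : ∀ {j} → j < m → δ j ≢ ε
    δ≢ε {j} j<m δj≡ε = contradiction (p-injective (m<n⇒m<1+n j<m) (s≤s j<m) pj≡p1+j) λ ()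
      where
      pj≡p1+j : p j ≡ p (suc j)
      pj≡p1+j = trans (sym (identityʳ (p j))) (trans (cong (p j ∙_) (sym δj≡ε)) (p-step j<m))

    p-onto : ∀ y → y ≢ ε → ∃ λ (j : Fin (suc m)) → p (toℕ j) ≡ y
    p-onto y y≢ε
      with injective⇒surjective (ε ∷ p ∘ toℕ) (∷-injective (p≢ε ∘ toℕ<n) (∘toℕ-injective p-injective)) y
    ... | zero  , ε≡y  = contradiction (sym ε≡y) y≢ε
    ... | suc j , pj≡y = j , pj≡y

    δ-onto : ∀ y → y ≢ ε → y ≢ s → ∃ λ (j : Fin m) → δ (toℕ j) ≡ y
    δ-onto y y≢ε y≢s
      with injective⇒surjective (ε ∷ s ∷ δ ∘ toℕ)
             (∷-injective s∷δ≢ε (∷-injective (δ≢s ∘ toℕ<n) (∘toℕ-injective δ-injective))) y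
      where
      s∷δ≢ε : ∀ j → (s ∷ δ ∘ toℕ) j ≢ ε
      s∷δ≢ε zero    = s≢ε
      s∷δ≢ε (suc j) = δ≢ε (toℕ<n j)
    ... | zero        , ε≡y  = contradiction (sym ε≡y) y≢ε
    ... | suc zero    , s≡y  = contradiction (sym s≡y) y≢s
    ... | suc (suc j) , δj≡y = j , δj≡y

    q-onto : ∀ y → ∃ λ (j : Fin M) → q (toℕ j) ≡ y
    q-onto = injective⇒surjective (q ∘ toℕ) (∘toℕ-injective q-injective)

    q-next : ∀ (t : Fin (suc m)) → q (toℕ (inject₁ t)) ∙ s ≡ q (toℕ (suc t))
    q-next t = trans (cong (λ j → q j ∙ s) (toℕ-inject₁ t)) (q-step (toℕ<n t))

    q-last : q (toℕ (fromℕ (suc m))) ∙ s ≡ q 0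
    q-last = trans (cong (λ j → q j ∙ s) (toℕ-fromℕ (suc m))) q-wrap

    special-vert : Fin M → V
    special-vert j = emb (q (toℕ j))

    rotated-vert : G → Fin M → V
    rotated-vert i zero    = ∞₂
    rotated-vert i (suc j) = emb (i ∙ p (toℕ j))

    special : Factor
    special =
      pairFactor ∞₁ ∞₂ (λ ()) special-vert (∘toℕ-injective q-injective ∘ emb-injective) (λ _ ()) (λ _ ()) onto
      where
      onto : ∀ x → x ≢ ∞₁ → x ≢ ∞₂ → ∃ λ j → special-vert j ≡ x
      onto ∞₁      x≢∞₁ _    = contradiction refl x≢∞₁
      onto ∞₂      _    x≢∞₂ = contradiction refl x≢∞₂
      onto (emb y) _    _    with q-onto y
      ... | j , qj≡y = j , emb-cong qj≡y

    rotated : G → Factor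
    rotated i =
      pairFactor ∞₁ (emb i) (λ ()) (rotated-vert i) injective (λ { zero () ; (suc _) () }) ≢i onto
      where
      injective : Injective _≡_ _≡_ (rotated-vert i)
      injective {zero}  {zero}  _ = refl
      injective {suc j} {suc j'} e = cong suc (∘toℕ-injective p-injective (∙-cancelˡ i _ _ (emb-injective e)))
      ≢i : ∀ j → rotated-vert i j ≢ emb i
      ≢i (suc j) e = p≢ε (toℕ<n j) (identityʳ-unique i _ (emb-injective e))
      onto : ∀ x → x ≢ ∞₁ → x ≢ emb i → ∃ λ j → rotated-vert i j ≡ x
      onto ∞₁      x≢∞₁ _   = contradiction refl x≢∞₁
      onto ∞₂      _    _   = zero , refl
      onto (emb y) _    y≢i with p-onto (i \\ y) (y≢i ∘ emb-cong ∘ sym ∘ \\≡ε⇒≡)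
      ... | j , pj≡i\\y = suc j , emb-cong (trans (cong (i ∙_) pj≡i\\y) (\\-leftDividesˡ i y))

    factor : Fin (suc M) → Factor
    factor zero    = special
    factor (suc i) = rotated i

    Owner : V → V → Fin (suc M) → Set
    Owner ∞₁      ∞₁      r = ⊥
    Owner ∞₁      ∞₂      r = r ≡ zero
    Owner ∞₁      (emb x) r = r ≡ suc x
    Owner ∞₂      ∞₁      r = r ≡ zero
    Owner ∞₂      ∞₂      r = ⊥
    Owner ∞₂      (emb x) r = ∃ λ i → r ≡ suc i × i ∙ p 0 ≡ x
    Owner (emb x) ∞₁      r = r ≡ suc x
    Owner (emb x) ∞₂      r = ∃ λ i → r ≡ suc i × i ∙ p m ≡ x
    Owner (emb x) (emb y) r =
      (r ≡ zero × x ∙ s ≡ y) ⊎ (∃₂ λ i t → r ≡ suc i × t < m × i ∙ p t ≡ x × i ∙ p (suc t) ≡ y)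

    inFactor⇒Owner : ∀ r {u v} → InFactor (factor r) u v → Owner u v r
    inFactor⇒Owner zero    (zero     , inj₁ (zero , refl , refl))  = refl
    inFactor⇒Owner zero    (zero     , inj₂ (refl , refl))         = refl
    inFactor⇒Owner zero    (suc zero , inj₁ (t , refl , refl))     = inj₁ (refl , q-next t)
    inFactor⇒Owner zero    (suc zero , inj₂ (refl , refl))         = inj₁ (refl , q-last)
    inFactor⇒Owner (suc i) (zero     , inj₁ (zero , refl , refl))  = refl
    inFactor⇒Owner (suc i) (zero     , inj₂ (refl , refl))         = refl
    inFactor⇒Owner (suc i) (suc zero , inj₁ (zero , refl , refl))  = i , refl , refl
    inFactor⇒Owner (suc i) (suc zero , inj₁ (suc t , refl , refl)) =
      inj₂ (i , toℕ t , refl , toℕ<n t , cong (λ j → i ∙ p j) (sym (toℕ-inject₁ t)) , refl)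
    inFactor⇒Owner (suc i) (suc zero , inj₂ (refl , refl))         =
      i , refl , cong (λ j → i ∙ p j) (sym (toℕ-fromℕ m))

    rotated-step : ∀ {i t x y} → t < m → i ∙ p t ≡ x → i ∙ p (suc t) ≡ y → x ∙ δ t ≡ y
    rotated-step {i} {t} t<m refl refl = trans (assoc i (p t) (δ t)) (cong (i ∙_) (p-step t<m))

    Owner-unique : ∀ u v {r r'} → Owner u v r → Owner u v r' → r ≡ r'
    Owner-unique ∞₁      ∞₂      r≡ r'≡ = trans r≡ (sym r'≡)
    Owner-unique ∞₁      (emb x) r≡ r'≡ = trans r≡ (sym r'≡)
    Owner-unique ∞₂      ∞₁      r≡ r'≡ = trans r≡ (sym r'≡)
    Owner-unique (emb x) ∞₁      r≡ r'≡ = trans r≡ (sym r'≡)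
    Owner-unique ∞₂      (emb x) (i , refl , e) (i' , refl , e') =
      cong suc (∙-cancelʳ (p 0) i i' (trans e (sym e')))
    Owner-unique (emb x) ∞₂      (i , refl , e) (i' , refl , e') =
      cong suc (∙-cancelʳ (p m) i i' (trans e (sym e')))
    Owner-unique (emb x) (emb y) (inj₁ (refl , _)) (inj₁ (refl , _)) = refl
    Owner-unique (emb x) (emb y) (inj₁ (_ , x∙s≡y)) (inj₂ (_ , t , _ , t<m , e₁ , e₂)) =
      contradiction (∙-cancelˡ x _ _ (trans (rotated-step t<m e₁ e₂) (sym x∙s≡y))) (δ≢s t<m)
    Owner-unique (emb x) (emb y) (inj₂ (_ , t , _ , t<m , e₁ , e₂)) (inj₁ (_ , x∙s≡y)) =
      contradiction (∙-cancelˡ x _ _ (trans (rotated-step t<m e₁ e₂) (sym x∙s≡y))) (δ≢s t<m)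
    Owner-unique (emb x) (emb y) (inj₂ (i , t , refl , t<m , e₁ , e₂))
                                 (inj₂ (i' , t' , refl , t'<m , e₁' , e₂'))
      with δ-injective t<m t'<m
             (∙-cancelˡ x _ _ (trans (rotated-step t<m e₁ e₂) (sym (rotated-step t'<m e₁' e₂'))))
    ... | refl = cong suc (∙-cancelʳ (p t) i i' (trans e₁ (sym e₁')))

    special-covers : ∀ {x y} → x ∙ s ≡ y → InFactor special (emb x) (emb y)
    special-covers {x} {y} x∙s≡y with q-onto x
    ... | j , qj≡x with inject₁-or-last j
    ...   | inj₁ (t , refl) = suc zero , inj₁ (t , emb-cong qj≡x , emb-cong
                                 (trans (sym (q-next t)) (trans (cong (_∙ s) qj≡x) x∙s≡y)))
    ...   | inj₂ refl       = suc zero , inj₂ (emb-cong qj≡x , emb-cong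
                                 (trans (sym q-last) (trans (cong (_∙ s) qj≡x) x∙s≡y)))

    rotated-covers : ∀ {x y} (t : Fin m) → x ∙ δ (toℕ t) ≡ y →
                     InFactor (rotated (x // p (toℕ t))) (emb x) (emb y)
    rotated-covers {x} {y} t x∙δt≡y = suc zero , inj₁ (suc t , emb-cong i∙pt≡x , emb-cong i∙p1+t≡y)
      where
      i : G
      i = x // p (toℕ t)
      i∙pt≡x : i ∙ p (toℕ (inject₁ t)) ≡ x
      i∙pt≡x = trans (cong (λ j → i ∙ p j) (toℕ-inject₁ t)) (//-rightDividesˡ (p (toℕ t)) x)
      i∙p1+t≡y : i ∙ p (suc (toℕ t)) ≡ y
      i∙p1+t≡y = begin
        i ∙ p (suc (toℕ t))          ≡⟨ cong (i ∙_) (p-step (toℕ<n t)) ⟨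
        i ∙ (p (toℕ t) ∙ δ (toℕ t))  ≡⟨ assoc i _ _ ⟨
        (i ∙ p (toℕ t)) ∙ δ (toℕ t)  ≡⟨ cong (_∙ δ (toℕ t)) (//-rightDividesˡ _ x) ⟩
        x ∙ δ (toℕ t)                ≡⟨ x∙δt≡y ⟩
        y                            ∎
        where open ≡-Reasoning

    cover : ∀ u v → u ≢ v → ∃ λ r → InFactor (factor r) u v
    cover ∞₁      ∞₁      u≢v = contradiction refl u≢v
    cover ∞₁      ∞₂      _   = zero , zero , inj₁ (zero , refl , refl)
    cover ∞₂      ∞₁      _   = zero , zero , inj₂ (refl , refl)
    cover ∞₂      ∞₂      u≢v = contradiction refl u≢v
    cover ∞₁      (emb x) _   = suc x , zero , inj₁ (zero , refl , refl)
    cover (emb x) ∞₁      _   = suc x , zero , inj₂ (refl , refl)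
    cover ∞₂      (emb x) _   =
      suc (x // p 0) , suc zero , inj₁ (zero , refl , emb-cong (//-rightDividesˡ (p 0) x))
    cover (emb x) ∞₂      _   = suc (x // p m) , suc zero , inj₂ (emb-cong last≡x , refl)
      where
      last≡x : (x // p m) ∙ p (toℕ (fromℕ m)) ≡ x
      last≡x = trans (cong (λ j → (x // p m) ∙ p j) (toℕ-fromℕ m)) (//-rightDividesˡ (p m) x)
    cover (emb x) (emb y) x≢y with (x \\ y) ≟ s
    ... | yes x\\y≡s = zero , special-covers (trans (cong (x ∙_) (sym x\\y≡s)) (\\-leftDividesˡ x y))
    ... | no  x\\y≢s with δ-onto (x \\ y) (x≢y ∘ emb-cong ∘ \\≡ε⇒≡) x\\y≢s
    ...   | t , δt≡x\\y = suc _ , rotated-covers t (trans (cong (x ∙_) δt≡x\\y) (\\-leftDividesˡ x y))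

    factorization : CycleFactorization (2 + M) 2 (len2 (2 + M))
    factorization = record
      { k      = suc M
      ; factor = factor
      ; covers = λ (u , v , u≢v) → cover u v u≢v
      ; unique = λ (u , v , _) r r' u→v∈r u→v∈r' →
                   Owner-unique u v (inFactor⇒Owner r u→v∈r) (inFactor⇒Owner r' u→v∈r')
      }

-- Starters in ℤ/M

module EvenOrder (k : ℕ) where

  m : ℕ
  m = suc (suc (k + k))

  open ℤₘ (suc (suc m))
  open OneRotational (IsAbelianGroup.isGroup isAbelianGroup)
  open import Algebra.Properties.AbelianGroup abelianGroup
    using (⁻¹-∙-comm; \\-leftDividesˡ; \\-leftDividesʳ)

  base : ℕ → Sign × ℕ
  base = interleave (λ a → Sign.+ , suc a) (λ a → Sign.- , suc a)

  base-even : ∀ a → base (a + a) ≡ (Sign.+ , suc a)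
  base-even = interleave-even (λ a → Sign.+ , suc a) (λ a → Sign.- , suc a)

  base-odd : ∀ a → base (suc (a + a)) ≡ (Sign.- , suc a)
  base-odd = interleave-odd (λ a → Sign.+ , suc a) (λ a → Sign.- , suc a)

  base-even′ : ∀ a → base (suc (suc (a + a))) ≡ (Sign.+ , suc (suc a))
  base-even′ = interleave-even′ (λ a → Sign.+ , suc a) (λ a → Sign.- , suc a)

  -- The differences of base, preceded by s = steps 0.
  steps : ℕ → Sign × ℕ
  steps j = alternating j , suc j

  base-step : ∀ j → signed (base j) +ₘ signed (steps (suc j)) ≡ signed (base (suc j))
  base-step j with parity j
  ... | even a rewrite base-even a | alternating-odd a | base-odd a = begin
    x +ₘ (-ₘ ι (suc (suc (a + a))))  ≡⟨ cong (λ n → x +ₘ (-ₘ ι n)) (2+b+b≡1+b+1+b a) ⟩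
    x +ₘ (-ₘ ι (suc a + suc a))      ≡⟨ cong (λ y → x +ₘ (-ₘ y)) (ι-+ (suc a) (suc a)) ⟩
    x +ₘ (-ₘ (x +ₘ x))               ≡⟨ cong (x +ₘ_) (⁻¹-∙-comm x x) ⟨
    x +ₘ ((-ₘ x) +ₘ (-ₘ x))          ≡⟨ \\-leftDividesˡ x (-ₘ x) ⟩
    -ₘ x                             ∎
    where
    open ≡-Reasoning
    x : Fin M
    x = ι (suc a)
  ... | odd a rewrite base-odd a | interleave-even′ (λ _ → Sign.+) (λ _ → Sign.-) a
                    | base-even′ a = begin
    (-ₘ x) +ₘ ι (suc (suc (suc (a + a))))  ≡⟨ cong (λ n → (-ₘ x) +ₘ ι n) (3+a+a a) ⟩
    (-ₘ x) +ₘ ι (suc a + suc (suc a))      ≡⟨ cong ((-ₘ x) +ₘ_) (ι-+ (suc a) (suc (suc a))) ⟩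
    (-ₘ x) +ₘ (x +ₘ ι (suc (suc a)))       ≡⟨ \\-leftDividesʳ x (ι (suc (suc a))) ⟩
    ι (suc (suc a))                        ∎
    where
    open ≡-Reasoning
    x : Fin M
    x = ι (suc a)
    3+a+a : ∀ a → suc (suc (suc (a + a))) ≡ suc a + suc (suc a)
    3+a+a = solve-∀

  M∤1+x+x : ∀ x → ¬ M ∣ suc (x + x)
  M∤1+x+x x M∣1+x+x = 2∤1+k+k x (∣-trans (divides (suc (suc k)) (M≡[2+k]*2 k)) M∣1+x+x)
    where
    M≡[2+k]*2 : ∀ k → 4 + (k + k) ≡ (2 + k) * 2
    M≡[2+k]*2 = solve-∀

  steps-opposite : ∀ i j → alternating i ≢ alternating j → ¬ M ∣ suc i + suc j
  steps-opposite i j σ≢τ with parity i | parity j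
  ... | even a | even b rewrite alternating-even a | alternating-even b = contradiction refl σ≢τ
  ... | odd  a | odd  b rewrite alternating-odd a  | alternating-odd b  = contradiction refl σ≢τ
  ... | even a | odd  b = subst (λ n → ¬ M ∣ n) (sym (odd-sum a b)) (M∤1+x+x (suc (a + b)))
    where
    odd-sum : ∀ a b → suc (a + a) + suc (suc (b + b)) ≡ suc (suc (a + b) + suc (a + b))
    odd-sum = solve-∀
  ... | odd  a | even b = subst (λ n → ¬ M ∣ n) (sym (odd-sum a b)) (M∤1+x+x (suc (a + b)))
    where
    odd-sum : ∀ a b → suc (suc (a + a)) + suc (b + b) ≡ suc (suc (a + b) + suc (a + b))
    odd-sum = solve-∀

  signed-steps-injective : ∀ {i j} → i < suc m → j < suc m → signed (steps i) ≡ signed (steps j) → i ≡ j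
  signed-steps-injective {i} {j} i<m j<m e =
    suc-injective (cong proj₂ (signed-injective (s≤s i<m) (s≤s j<m) (steps-opposite i j) e))

  base-shape : ∀ {j} → j < suc m → (∃ λ a → base j ≡ (Sign.+ , suc a) × a ≤ suc k)
                                 ⊎ (∃ λ a → base j ≡ (Sign.- , suc a) × a ≤ k)
  base-shape {j} j<m with parity j | j<m
  ... | even a | s≤s le       = inj₁ (a , base-even a , a+a≤2+b+b⇒a≤1+b le)
  ... | odd  a | s≤s (s≤s le) = inj₂ (a , base-odd a , a+a≤1+b+b⇒a≤b le)

  1+a<M : ∀ {a} → a ≤ suc k → suc a < M
  1+a<M a≤1+k = s≤s (s≤s (≤-trans a≤1+k (s≤s (≤-trans (m≤m+n k k) (n≤1+n _)))))

  base-magnitude< : ∀ {j} → j < suc m → proj₂ (base j) < M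
  base-magnitude< j<m with base-shape j<m
  ... | inj₁ (a , e , a≤1+k) rewrite e = 1+a<M a≤1+k
  ... | inj₂ (a , e , a≤k)   rewrite e = 1+a<M (≤-trans a≤k (n≤1+n k))

  base-sum< : ∀ {a b} → a ≤ suc k → b ≤ k → suc a + suc b < M
  base-sum< a≤1+k b≤k = s≤s (≤-trans (+-mono-≤ (s≤s a≤1+k) (s≤s b≤k)) (≤-reflexive (2+k+1+k≡3+k+k k)))
    where
    2+k+1+k≡3+k+k : ∀ k → suc (suc k) + suc k ≡ suc (suc (suc (k + k)))
    2+k+1+k≡3+k+k = solve-∀

  base-opposite : ∀ {i j} → i < suc m → j < suc m →
                  proj₁ (base i) ≢ proj₁ (base j) → ¬ M ∣ proj₂ (base i) + proj₂ (base j)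
  base-opposite i<m j<m σ≢τ with base-shape i<m | base-shape j<m
  ... | inj₁ (a , ea , _)   | inj₁ (b , eb , _)   rewrite ea | eb = contradiction refl σ≢τ
  ... | inj₂ (a , ea , _)   | inj₂ (b , eb , _)   rewrite ea | eb = contradiction refl σ≢τ
  ... | inj₁ (a , ea , a≤)  | inj₂ (b , eb , b≤)  rewrite ea | eb =
    positive<M⇒∤ (s≤s z≤n) (base-sum< a≤ b≤)
  ... | inj₂ (a , ea , a≤)  | inj₁ (b , eb , b≤)  rewrite ea | eb =
    positive<M⇒∤ (s≤s z≤n) (subst (_< M) (+-comm (suc b) (suc a)) (base-sum< b≤ a≤))

  base-injective : ∀ {i j} → i < suc m → j < suc m → signed (base i) ≡ signed (base j) → i ≡ j
  base-injective i<m j<m e =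
    interleave-injective (suc-injective ∘ cong proj₂) (suc-injective ∘ cong proj₂) (λ _ _ ())
      (signed-injective (base-magnitude< i<m) (base-magnitude< j<m) (base-opposite i<m j<m) e)

  base-positive : ∀ j → 0 < proj₂ (base j)
  base-positive j with parity j
  ... | even a rewrite base-even a = s≤s z≤n
  ... | odd  a rewrite base-odd a  = s≤s z≤n

  starter : Starter
  starter = record
    { p           = signed ∘ base
    ; p-injective = base-injective
    ; p≢ε         = λ {j} j<m → signed≢0ₘ {proj₁ (base j)} (base-positive j) (base-magnitude< j<m)
    ; δ           = signed ∘ steps ∘ suc
    ; p-step      = λ {j} _ → base-step j
    ; δ-injective = λ i<m j<m e → suc-injective (signed-steps-injective (s≤s i<m) (s≤s j<m) e)
    ; s           = signed (steps 0)
    ; δ≢s         = λ j<m e → contradiction (signed-steps-injective (s≤s j<m) (s≤s z≤n) e) λ ()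
    ; q           = ι
    ; q-injective = ι-injective
    ; q-step      = λ {j} _ → trans (sym (ι-+ j 1)) (cong ι (+-comm j 1))
    ; q-wrap      = trans (sym (ι-+ (suc m) 1)) (trans (cong ι (+-comm (suc m) 1)) (ι-+M 0))
    }

  factorization : CycleFactorization (2 + M) 2 (len2 (2 + M))
  factorization = FromStarter.factorization starter

module OddOrder (k : ℕ) where

  m : ℕ
  m = suc (k + k)

  h : ℕ
  h = suc k

  open ℤₘ (suc (suc m))
  open OneRotational (IsAbelianGroup.isGroup isAbelianGroup)
  open import Algebra.Properties.AbelianGroup abelianGroup using (x≈z//y)

  2h<M : h + h < M
  2h<M = s≤s (s≤s (≤-reflexive (+-suc k k)))

  zigzag : ℕ → ℕ
  zigzag = interleave suc (h ∸_)

  zigzag-even : ∀ a → zigzag (a + a) ≡ suc a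
  zigzag-even = interleave-even suc (h ∸_)

  zigzag-odd : ∀ a → zigzag (suc (a + a)) ≡ h ∸ a
  zigzag-odd = interleave-odd suc (h ∸_)

  zigzag-diff : ℕ → Sign × ℕ
  zigzag-diff t = alternating t , k ∸ t

  zigzag-range : ∀ {t} → t ≤ k → 0 < zigzag t × zigzag t ≤ h
  zigzag-range {t} t≤k with parity t
  ... | even a rewrite zigzag-even a = s≤s z≤n , s≤s (≤-trans (m≤m+n a a) t≤k)
  ... | odd  a rewrite zigzag-odd a  =
    m<n⇒0<n∸m (s≤s (≤-trans (m≤m+n a a) (≤-trans (n≤1+n _) t≤k))) , m∸n≤m h a

  ends-differ : ∀ {a b} → a + a ≤ k → suc (b + b) ≤ k → suc a ≢ h ∸ b
  ends-differ {a} {b} 2a≤k 1+2b≤k e =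
    <-irrefl a+b≡k (double-<-cancel (subst (_< k + k) (shuffle a b) (+-mono-≤-< 2a≤k 1+2b≤k)))
    where
    shuffle : ∀ a b → (a + a) + (b + b) ≡ (a + b) + (a + b)
    shuffle = solve-∀
    b≤h : b ≤ h
    b≤h = ≤-trans (m≤m+n b b) (≤-trans (n≤1+n _) (≤-trans 1+2b≤k (n≤1+n k)))
    a+b≡k : a + b ≡ k
    a+b≡k = suc-injective (trans (cong (_+ b) e) (m∸n+n≡m b≤h))

  zigzag-injective : ∀ {t t'} → t ≤ k → t' ≤ k → zigzag t ≡ zigzag t' → t ≡ t'
  zigzag-injective {t} {t'} t≤k t'≤k e with parity t | parity t'
  ... | even a | even b rewrite zigzag-even a | zigzag-even b = cong (λ x → x + x) (suc-injective e)
  ... | odd  a | odd  b rewrite zigzag-odd a  | zigzag-odd b  =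
    cong (λ x → suc (x + x)) (∸-cancelˡ-≡ (a≤h {a} t≤k) (a≤h {b} t'≤k) e)
    where
    a≤h : ∀ {a} → suc (a + a) ≤ k → a ≤ h
    a≤h {a} le = ≤-trans (m≤m+n a a) (≤-trans (n≤1+n _) (≤-trans le (n≤1+n k)))
  ... | even a | odd  b rewrite zigzag-even a | zigzag-odd b  =
    contradiction e (ends-differ {a} {b} t≤k t'≤k)
  ... | odd  a | even b rewrite zigzag-odd a  | zigzag-even b =
    contradiction (sym e) (ends-differ {b} {a} t'≤k t≤k)

  zigzag-step : ∀ {t} → suc t ≤ k → ι (zigzag t) +ₘ signed (zigzag-diff t) ≡ ι (zigzag (suc t))
  zigzag-step {t} 1+t≤k with parity t
  ... | even a rewrite zigzag-even a | alternating-even a | zigzag-odd a =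
    trans (sym (ι-+ (suc a) (k ∸ (a + a)))) (cong ι sum≡)
    where
    rearrange : ∀ a r → a + (suc a + r) ≡ suc ((a + a) + r)
    rearrange = solve-∀
    sum≡ : suc a + (k ∸ (a + a)) ≡ h ∸ a
    sum≡ = a+x≡n⇒x≡n∸a (trans (rearrange a _) (cong suc (m+[n∸m]≡n (≤-trans (n≤1+n _) 1+t≤k))))
  ... | odd a rewrite zigzag-odd a | alternating-odd a | interleave-even′ suc (h ∸_) a =
    sym (x≈z//y (ι (suc (suc a))) (ι (k ∸ suc (a + a))) (ι (h ∸ a))
                (trans (sym (ι-+ (suc (suc a)) (k ∸ suc (a + a)))) (cong ι sum≡)))
    where
    rearrange : ∀ a r → a + (suc (suc a) + r) ≡ suc (suc (a + a) + r)
    rearrange = solve-∀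
    sum≡ : suc (suc a) + (k ∸ suc (a + a)) ≡ h ∸ a
    sum≡ = a+x≡n⇒x≡n∸a (trans (rearrange a _) (cong suc (m+[n∸m]≡n (≤-trans (n≤1+n _) 1+t≤k))))

  base : ℕ → ℕ
  base = revAppend k zigzag (λ t → zigzag t + h)

  base-left : ∀ {t} → t ≤ k → base (k ∸ t) ≡ zigzag t
  base-left = revAppend-left k zigzag (λ t → zigzag t + h)

  base-right : ∀ t → base (suc k + t) ≡ zigzag t + h
  base-right = revAppend-right k zigzag (λ t → zigzag t + h)

  right≤k : ∀ {t} → suc k + t < suc m → t ≤ k
  right≤k (s≤s (s≤s le)) = +-cancelˡ-≤ k _ _ le

  base-range : ∀ {j} → j < suc m → 0 < base j × base j ≤ h + h
  base-range {j} j<2h with side k j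
  ... | left t t≤k rewrite base-left t≤k =
    proj₁ (zigzag-range t≤k) , ≤-trans (proj₂ (zigzag-range t≤k)) (m≤m+n h h)
  ... | right t rewrite base-right t =
    ≤-trans 0<zt (m≤m+n _ h) , +-monoˡ-≤ h zt≤h
    where
    0<zt : 0 < zigzag t
    0<zt = proj₁ (zigzag-range (right≤k j<2h))
    zt≤h : zigzag t ≤ h
    zt≤h = proj₂ (zigzag-range (right≤k j<2h))

  base<M : ∀ {j} → j < suc m → base j < M
  base<M j<2h = ≤-trans (s≤s (proj₂ (base-range j<2h))) 2h<M

  zigzag≢zigzag+h : ∀ {t t'} → t ≤ k → t' ≤ k → zigzag t ≢ zigzag t' + h
  zigzag≢zigzag+h t≤k t'≤k e =
    <-irrefl e (≤-trans (s≤s (proj₂ (zigzag-range t≤k))) (+-monoˡ-≤ h (proj₁ (zigzag-range t'≤k))))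

  base-injective : ∀ {i j} → i < suc m → j < suc m → base i ≡ base j → i ≡ j
  base-injective {i} {j} i<2h j<2h e with side k i | side k j
  ... | left t t≤k | left t' t'≤k rewrite base-left t≤k | base-left t'≤k =
    cong (k ∸_) (zigzag-injective t≤k t'≤k e)
  ... | right t | right t' rewrite base-right t | base-right t' =
    cong (suc k +_) (zigzag-injective (right≤k i<2h) (right≤k j<2h) (+-cancelʳ-≡ _ _ _ e))
  ... | left t t≤k | right t' rewrite base-left t≤k | base-right t' =
    contradiction e (zigzag≢zigzag+h t≤k (right≤k j<2h))
  ... | right t | left t' t'≤k rewrite base-right t | base-left t'≤k =
    contradiction (sym e) (zigzag≢zigzag+h t'≤k (right≤k i<2h))

  -- mirrored 0 is the jump zigzag 0 → zigzag 0 + h in the middle of base, and mirrored (1 + t)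
  -- is the step zigzag (1 + t) → zigzag t in its reversed first half.
  mirrored : ℕ → Sign × ℕ
  mirrored zero    = Sign.+ , h
  mirrored (suc t) = Sign.opposite (alternating t) , k ∸ t

  diff : ℕ → Sign × ℕ
  diff = revAppend k mirrored zigzag-diff

  diff-middle : diff k ≡ (Sign.+ , h)
  diff-middle = revAppend-left k mirrored zigzag-diff {zero} z≤n

  diff-left : ∀ {t} → suc t ≤ k → diff (k ∸ suc t) ≡ (Sign.opposite (alternating t) , k ∸ t)
  diff-left = revAppend-left k mirrored zigzag-diff

  diff-right : ∀ t → diff (suc k + t) ≡ zigzag-diff t
  diff-right = revAppend-right k mirrored zigzag-diff

  right<k : ∀ {t} → suc k + t < m → t < k
  right<k {t} (s≤s le) = +-cancelˡ-≤ k (suc t) k (subst (_≤ k + k) (sym (+-suc k t)) le)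

  1+[k∸1+t]≡k∸t : ∀ {t} → suc t ≤ k → suc (k ∸ suc t) ≡ k ∸ t
  1+[k∸1+t]≡k∸t 1+t≤k = sym (+-∸-assoc 1 1+t≤k)

  base-step : ∀ {j} → j < m → ι (base j) +ₘ signed (diff j) ≡ ι (base (suc j))
  base-step {j} j<m with side k j
  ... | left zero _ rewrite base-left {zero} z≤n | diff-middle | cong base (sym (+-identityʳ (suc k)))
                          | base-right 0 =
    sym (ι-+ (zigzag 0) h)
  ... | left (suc t) 1+t≤k = begin
    ι (base (k ∸ suc t)) +ₘ signed (diff (k ∸ suc t))
      ≡⟨ cong₂ (λ x y → ι x +ₘ signed y) (base-left 1+t≤k) (diff-left 1+t≤k) ⟩
    ι (zigzag (suc t)) +ₘ signed (Sign.opposite (alternating t) , k ∸ t)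
      ≡⟨ cong (ι (zigzag (suc t)) +ₘ_) (signed-opposite (alternating t) (k ∸ t)) ⟩
    ι (zigzag (suc t)) +ₘ (-ₘ signed (zigzag-diff t))
      ≡⟨ x≈z//y (ι (zigzag t)) (signed (zigzag-diff t)) (ι (zigzag (suc t))) (zigzag-step 1+t≤k) ⟨
    ι (zigzag t)
      ≡⟨ cong ι (base-left (<⇒≤ 1+t≤k)) ⟨
    ι (base (k ∸ t))
      ≡⟨ cong (ι ∘ base) (1+[k∸1+t]≡k∸t 1+t≤k) ⟨
    ι (base (suc (k ∸ suc t)))
      ∎
    where open ≡-Reasoning
  ... | right t = begin
    ι (base (suc k + t)) +ₘ signed (diff (suc k + t))
      ≡⟨ cong₂ (λ x y → ι x +ₘ signed y) (base-right t) (diff-right t) ⟩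
    ι (zigzag t + h) +ₘ g          ≡⟨ cong (_+ₘ g) (ι-+ (zigzag t) h) ⟩
    (ι (zigzag t) +ₘ ι h) +ₘ g     ≡⟨ +ₘ-assoc (ι (zigzag t)) (ι h) g ⟩
    ι (zigzag t) +ₘ (ι h +ₘ g)     ≡⟨ cong (ι (zigzag t) +ₘ_) (+ₘ-comm (ι h) g) ⟩
    ι (zigzag t) +ₘ (g +ₘ ι h)     ≡⟨ +ₘ-assoc (ι (zigzag t)) g (ι h) ⟨
    (ι (zigzag t) +ₘ g) +ₘ ι h     ≡⟨ cong (_+ₘ ι h) (zigzag-step (right<k j<m)) ⟩
    ι (zigzag (suc t)) +ₘ ι h      ≡⟨ ι-+ (zigzag (suc t)) h ⟨
    ι (zigzag (suc t) + h)         ≡⟨ cong ι (base-right (suc t)) ⟨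
    ι (base (suc k + suc t))       ≡⟨ cong (ι ∘ base) (+-suc (suc k) t) ⟩
    ι (base (suc (suc k + t)))     ∎
    where
    open ≡-Reasoning
    g : Fin M
    g = signed (zigzag-diff t)

  k∸t-range : ∀ {t} → t < k → 0 < k ∸ t × k ∸ t ≤ h
  k∸t-range {t} t<k = m<n⇒0<n∸m t<k , ≤-trans (m∸n≤m k t) (n≤1+n k)

  k∸t≢h : ∀ t → k ∸ t ≢ h
  k∸t≢h t e = <-irrefl e (s≤s (m∸n≤m k t))

  diff-range : ∀ {j} → j < m → 0 < proj₂ (diff j) × proj₂ (diff j) ≤ h
  diff-range {j} j<m with side k j
  ... | left zero    _     rewrite diff-middle       = s≤s z≤n , ≤-refl
  ... | left (suc t) 1+t≤k rewrite diff-left 1+t≤k  = k∸t-range 1+t≤k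
  ... | right t            rewrite diff-right t     = k∸t-range (right<k j<m)

  signed-injective≤h : ∀ {σ a τ b} → 0 < a → a ≤ h → 0 < b → b ≤ h →
                       signed (σ , a) ≡ signed (τ , b) → (σ , a) ≡ (τ , b)
  signed-injective≤h {a = a} {b = b} 0<a a≤h 0<b b≤h =
    signed-injective (<M a≤h) (<M b≤h)
      (λ _ → positive<M⇒∤ (≤-trans 0<a (m≤m+n a b)) (≤-trans (s≤s (+-mono-≤ a≤h b≤h)) 2h<M))
    where
    <M : ∀ {x} → x ≤ h → x < M
    <M x≤h = ≤-trans (s≤s x≤h) (≤-trans (s≤s (m≤m+n h h)) 2h<M)

  signed-diff-injective : ∀ {i j} → i < m → j < m → signed (diff i) ≡ signed (diff j) → diff i ≡ diff j
  signed-diff-injective i<m j<m =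
    signed-injective≤h (proj₁ (diff-range i<m)) (proj₂ (diff-range i<m))
                       (proj₁ (diff-range j<m)) (proj₂ (diff-range j<m))

  diff-injective : ∀ {i j} → i < m → j < m → diff i ≡ diff j → i ≡ j
  diff-injective {i} {j} i<m j<m e with side k i | side k j
  ... | left zero _ | left zero _ = refl
  ... | left zero _ | left (suc t') 1+t'≤k rewrite diff-middle | diff-left 1+t'≤k =
    contradiction (sym (cong proj₂ e)) (k∸t≢h t')
  ... | left zero _ | right t' rewrite diff-middle | diff-right t' =
    contradiction (sym (cong proj₂ e)) (k∸t≢h t')
  ... | left (suc t) 1+t≤k | left zero _ rewrite diff-left 1+t≤k | diff-middle =
    contradiction (cong proj₂ e) (k∸t≢h t)
  ... | right t | left zero _ rewrite diff-right t | diff-middle =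
    contradiction (cong proj₂ e) (k∸t≢h t)
  ... | left (suc t) 1+t≤k | left (suc t') 1+t'≤k rewrite diff-left 1+t≤k | diff-left 1+t'≤k =
    cong (λ x → k ∸ suc x) (∸-cancelˡ-≡ (<⇒≤ 1+t≤k) (<⇒≤ 1+t'≤k) (cong proj₂ e))
  ... | right t | right t' rewrite diff-right t | diff-right t' =
    cong (suc k +_) (∸-cancelˡ-≡ (<⇒≤ (right<k i<m)) (<⇒≤ (right<k j<m)) (cong proj₂ e))
  ... | left (suc t) 1+t≤k | right t' rewrite diff-left 1+t≤k | diff-right t'
    with ∸-cancelˡ-≡ (<⇒≤ 1+t≤k) (<⇒≤ (right<k j<m)) (cong proj₂ e)
  ... | refl = contradiction (sym (cong proj₁ e)) (s≢opposite[s] (alternating t))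
  diff-injective {i} {j} i<m j<m e | right t | left (suc t') 1+t'≤k
    rewrite diff-right t | diff-left 1+t'≤k
    with ∸-cancelˡ-≡ (<⇒≤ (right<k i<m)) (<⇒≤ 1+t'≤k) (cong proj₂ e)
  ... | refl = contradiction (cong proj₁ e) (s≢opposite[s] (alternating t))

  s : Fin M
  s = signed (Sign.- , h)

  diff≢s : ∀ {j} → j < m → signed (diff j) ≢ s
  diff≢s {j} j<m e = excluded (side k j)
    (signed-injective≤h {τ = Sign.-} (proj₁ (diff-range j<m)) (proj₂ (diff-range j<m)) (s≤s z≤n) ≤-refl e)
    where
    excluded : ∀ {j} → Side k j → diff j ≢ (Sign.- , h)
    excluded (left zero _)        e′ = contradiction (cong proj₁ (trans (sym diff-middle) e′)) λ ()
    excluded (left (suc t) 1+t≤k) e′ = k∸t≢h t (cong proj₂ (trans (sym (diff-left 1+t≤k)) e′))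
    excluded (right t)            e′ = k∸t≢h t (cong proj₂ (trans (sym (diff-right t)) e′))

  orbit : ℕ → ℕ
  orbit = interleave (λ a → a) (λ a → suc (h + a))

  orbit-even : ∀ a → orbit (a + a) ≡ a
  orbit-even = interleave-even (λ a → a) (λ a → suc (h + a))

  orbit-odd : ∀ a → orbit (suc (a + a)) ≡ suc (h + a)
  orbit-odd = interleave-odd (λ a → a) (λ a → suc (h + a))

  even<M⇒≤h : ∀ {a} → a + a < M → a ≤ h
  even<M⇒≤h (s≤s le) = a+a≤2+b+b⇒a≤1+b le

  odd<M⇒≤k : ∀ {a} → suc (a + a) < M → a ≤ k
  odd<M⇒≤k (s≤s (s≤s le)) = a+a≤1+b+b⇒a≤b le

  orbit<M : ∀ {j} → j < M → orbit j < M
  orbit<M {j} j<M with parity j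
  ... | even a rewrite orbit-even a = s≤s (≤-trans (even<M⇒≤h j<M) (s≤s (≤-trans (m≤m+n k k) (n≤1+n _))))
  ... | odd  a rewrite orbit-odd a  = s≤s (s≤s (s≤s (+-monoʳ-≤ k (odd<M⇒≤k j<M))))

  orbit-injective : ∀ {i j} → i < M → j < M → orbit i ≡ orbit j → i ≡ j
  orbit-injective {i} {j} i<M j<M e with parity i | parity j
  ... | even a | even b rewrite orbit-even a | orbit-even b = cong (λ x → x + x) e
  ... | odd  a | odd  b rewrite orbit-odd a  | orbit-odd b  =
    cong (λ x → suc (x + x)) (+-cancelˡ-≡ h _ _ (suc-injective e))
  ... | even a | odd  b rewrite orbit-even a | orbit-odd b  =
    contradiction (≤-trans (s≤s (m≤m+n h b)) (≤-reflexive (sym e))) (<⇒≱ (s≤s (even<M⇒≤h i<M)))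
  ... | odd  a | even b rewrite orbit-odd a  | orbit-even b =
    contradiction (≤-trans (s≤s (m≤m+n h a)) (≤-reflexive e)) (<⇒≱ (s≤s (even<M⇒≤h j<M)))

  orbit-step : ∀ j → ι (orbit j) +ₘ s ≡ ι (orbit (suc j))
  orbit-step j with parity j
  ... | even a rewrite orbit-even a | orbit-odd a =
    sym (x≈z//y (ι (suc (h + a))) (ι h) (ι a)
                (trans (sym (ι-+ (suc (h + a)) h)) (trans (cong ι (wraps k a)) (ι-+M a))))
    where
    wraps : ∀ k a → suc (suc k + a) + suc k ≡ a + suc (suc (suc (k + k)))
    wraps = solve-∀
  ... | odd a rewrite orbit-odd a | interleave-even′ (λ a → a) (λ a → suc (h + a)) a =
    sym (x≈z//y (ι (suc a)) (ι h) (ι (suc (h + a)))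
                (trans (sym (ι-+ (suc a) h)) (cong (ι ∘ suc) (+-comm a h))))

  orbit-wrap : ι (orbit (suc m)) +ₘ s ≡ ι (orbit 0)
  orbit-wrap rewrite interleave-even′ (λ a → a) (λ a → suc (h + a)) k =
    trans (+ₘ-comm (ι h) _) (-ₘ-inverseˡ (ι h))

  starter : Starter
  starter = record
    { p           = ι ∘ base
    ; p-injective = λ i<2h j<2h e → base-injective i<2h j<2h (ι-injective (base<M i<2h) (base<M j<2h) e)
    ; p≢ε         = λ j<2h → ι≢0ₘ (proj₁ (base-range j<2h)) (base<M j<2h)
    ; δ           = signed ∘ diff
    ; p-step      = base-step
    ; δ-injective = λ i<m j<m e → diff-injective i<m j<m (signed-diff-injective i<m j<m e)
    ; s           = s
    ; δ≢s         = diff≢s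
    ; q           = ι ∘ orbit
    ; q-injective = λ i<M j<M e → orbit-injective i<M j<M (ι-injective (orbit<M i<M) (orbit<M j<M) e)
    ; q-step      = λ {j} _ → orbit-step j
    ; q-wrap      = orbit-wrap
    }

  factorization : CycleFactorization (2 + M) 2 (len2 (2 + M))
  factorization = FromStarter.factorization starter

theorem3p4 : ∀ (n : ℕ) → 5 ≤ n → CycleFactorization n 2 (len2 n)
theorem3p4 (suc (suc (suc (suc (suc K))))) (s≤s (s≤s (s≤s (s≤s (s≤s _))))) with parity K
... | even k = OddOrder.factorization k
... | odd  k = EvenOrder.factorization k
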